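{- Let a finite directed acyclic precedence graph on blocks $\{1,\dots,n\}$ be given, let $w\in\mathbb{R}^n$ and $\gamma>0$, and let $\hat f(x)=-w^\top x+\gamma V_{\mathrm{anc}}(x)$ over $[0,1]^n$, where $$V_{\mathrm{anc}}(x):=\sum_{c=1}^n\ \sum_{\alpha\in \mathrm{Anc}(c)}x_c(1-x_\alpha).$$ Assume that core binarity holds, i.e. every local minimizer of $\hat f$ over $[0,1]^n$ lies in $\{0,1\}^n$. Then $V_{\mathrm{anc}}$ is locally repairable with margin $\delta=1$ relative to the single-bit removal directions $D:=\{ -e_i: i=1,\dots,n\}$. Moreover, if $\gamma>\max_i w_i$, then every binary local minimizer of $\hat f$ over $[0,1]^n$ is feasible.
   Context: For each block $i$, $P(i)\subseteq\{1,\dots,n\}$ is the set of its predecessors, which must be extracted before $i$; the graph with an edge $j\to i$ for each $j\in P(i)$ is acyclic. $\mathrm{Anc}(c)$ is the set of all strict ancestors of $c$, i.e. nodes from which $c$ can be reached by a directed path of length at least one. A binary point $x\in\{0,1\}^n$ is feasible if $x_i\le x_j$ for all $i$ and all $j\in P(i)$, and infeasible otherwise. The tangent cone of the box at $x\in[0,1]^n$ is $T(x):=\{d\in\mathbb{R}^n: x_i=0\Rightarrow d_i\ge0,\ x_i=1\Rightarrow d_i\le 0\}$. Here $V_{\mathrm{anc}}$ is locally repairable with margin $\delta$ relative to $D$ if for every infeasible $x\in\{0,1\}^n$ there is $d\in D\cap T(x)$ with $\langle\nabla V_{\mathrm{anc}}(x),d\rangle\le-\delta$. The vectors $e_i$ are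 the standard basis vectors of $\mathbb{R}^n$. A local minimizer over $[0,1]^n$ is a point of the box minimizing $\hat f$ among all points of the box in some neighborhood of it. -}

module Defs where

open import Algebra.Bundles using (CommutativeRing)
import Algebra.Definitions as AlgebraDefinitions
import Algebra.Definitions.RawMonoid as RawMonoidDefinitions
import Algebra.Properties.Monoid.Sum as MonoidSum
open import Data.Bool.Base using (if_then_else_)
open import Data.Fin.Base using (Fin)
open import Data.Fin.Induction using (spo-wellFounded)
import Data.Fin.Properties as Fin
open import Data.Fin.Subset using (Subset; _∈_)
open import Data.Fin.Subset.Properties using (_∈?_)
open import Data.Nat.Base as ℕ using (ℕ)
open import Data.Product.Base using (∃; ∃-syntax; _×_; _,_)
open import Data.Sum.Base using (_⊎_; inj₁; inj₂)
open import Data.Vec.Functional using (Vector)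
open import Induction.WellFounded using (WellFounded; Acc; acc)
open import Level using (_⊔_) renaming (suc to lsuc)
open import Relation.Binary.Core using (Rel)
open import Relation.Binary.Construct.Closure.Transitive
  using (TransClosure; [_]; _∷_; _++_; _∷ʳ_)
open import Relation.Binary.Definitions using (Cotransitive; Decidable)
open import Relation.Binary.PropositionalEquality
  using (_≡_; refl; isEquivalence; resp₂)
open import Relation.Binary.Structures using (IsStrictPartialOrder)
open import Relation.Nullary.Decidable using (Dec; yes; no; does; map′; _×-dec_; _⊎-dec_)
open import Relation.Nullary.Negation using (¬_)

-- The real numbers, given axiomatically as a Cauchy-complete Archimedean
-- ordered field.  The order axioms are the constructive ones (cotransitivity
-- and tightness in place of trichotomy), so that both the classical and the
-- constructive reals are models; classically, every model is isomorphic to ℝ.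

record RealNumbers c ℓ₁ ℓ₂ : Set (lsuc (c ⊔ ℓ₁ ⊔ ℓ₂)) where
  field
    commutativeRing : CommutativeRing c ℓ₁

  open CommutativeRing commutativeRing public

  infix 4 _<_ _≤_ ∣_∣<_

  field
    _<_                  : Rel Carrier ℓ₂
    isStrictPartialOrder : IsStrictPartialOrder _≈_ _<_
    <-cotrans            : Cotransitive _<_
    <-tight              : ∀ {x y} → ¬ x < y → ¬ y < x → x ≈ y
    0<1                  : 0# < 1#
    +-monoˡ-<            : ∀ z {x y} → x < y → x + z < y + z
    *-pos                : ∀ {x y} → 0# < x → 0# < y → 0# < x * y
    invertible           : ∀ {x} → x < 0# ⊎ 0# < x →
                           AlgebraDefinitions.Invertible _≈_ 1# _*_ x

  _≤_ : Rel Carrier ℓ₂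
  x ≤ y = ¬ y < x

  -- ∣ x ∣< ε  says that the absolute value of x is less than ε.
  ∣_∣<_ : Rel Carrier ℓ₂
  ∣ x ∣< ε = (- ε < x) × (x < ε)

  open RawMonoidDefinitions +-rawMonoid public using () renaming (_×_ to _·_)

  IsCauchy : (ℕ → Carrier) → Set (c ⊔ ℓ₂)
  IsCauchy s = ∀ ε → 0# < ε → ∃[ N ] ∀ m k → N ℕ.≤ m → N ℕ.≤ k → ∣ s m - s k ∣< ε

  _ConvergesTo_ : (ℕ → Carrier) → Carrier → Set (c ⊔ ℓ₂)
  s ConvergesTo l = ∀ ε → 0# < ε → ∃[ N ] ∀ m → N ℕ.≤ m → ∣ s m - l ∣< ε

  field
    archimedean : ∀ x → ∃[ m ] x < m · 1#
    complete    : ∀ s → IsCauchy s → ∃[ l ] s ConvergesTo l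

-- pred i is the set P(i), and Edge j i is the edge j → i.

record PrecedenceGraph (n : ℕ) : Set where
  field
    pred : Fin n → Subset n

  Edge : Rel (Fin n) _
  Edge j i = j ∈ pred i

  Ancestor : Rel (Fin n) _
  Ancestor = TransClosure Edge

  field
    acyclic : ∀ i → ¬ Ancestor i i

  ancestor-wellFounded : WellFounded Ancestor
  ancestor-wellFounded = spo-wellFounded record
    { isEquivalence = isEquivalence
    ; irrefl        = λ { refl → acyclic _ }
    ; trans         = _++_
    ; <-resp-≈      = resp₂ Ancestor
    }

  ancestor? : Decidable Ancestor
  ancestor? α c = go c (ancestor-wellFounded c)
    where
    Step : Fin n → Fin n → Set
    Step c p = p ∈ pred c × (α ≡ p ⊎ Ancestor α p)

    step⇒ancestor : ∀ {c} → ∃ (Step c) → Ancestor α c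
    step⇒ancestor (_ , e , inj₁ refl) = [ e ]
    step⇒ancestor (_ , e , inj₂ a)    = a ∷ʳ e

    ancestor⇒step : ∀ {β c} → Ancestor β c →
                    ∃[ p ] p ∈ pred c × (β ≡ p ⊎ Ancestor β p)
    ancestor⇒step [ e ] = _ , e , inj₁ refl
    ancestor⇒step (e ∷ a) with ancestor⇒step a
    ... | p , e′ , inj₁ refl = p , e′ , inj₂ [ e ]
    ... | p , e′ , inj₂ a′   = p , e′ , inj₂ (e ∷ a′)

    go : ∀ c → Acc Ancestor c → Dec (Ancestor α c)
    go c (acc rs) = map′ step⇒ancestor ancestor⇒step (Fin.any? step?)
      where
      step? : ∀ p → Dec (Step c p)
      step? p with p ∈? pred c
      ... | no p∉  = no λ { (p∈ , _) → p∉ p∈ }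
      ... | yes p∈ = yes p∈ ×-dec (α Fin.≟ p ⊎-dec go p (rs [ p∈ ]))

module Euclidean {c ℓ₁ ℓ₂} (ℝ : RealNumbers c ℓ₁ ℓ₂) (n : ℕ) where

  open RealNumbers ℝ
  open MonoidSum +-monoid public using (sum)

  Point : Set c
  Point = Vector Carrier n

  ⟨_,_⟩ : Point → Point → Carrier
  ⟨ u , v ⟩ = sum λ i → u i * v i

  e : Fin n → Point
  e i j = if does (i Fin.≟ j) then 1# else 0#

  Binary : Point → Set ℓ₁
  Binary x = ∀ i → x i ≈ 0# ⊎ x i ≈ 1#

  InBox : Point → Set ℓ₂
  InBox x = ∀ i → 0# ≤ x i × x i ≤ 1#

  TangentCone : Point → Point → Set (ℓ₁ ⊔ ℓ₂)
  TangentCone x d = ∀ i → (x i ≈ 0# → 0# ≤ d i) × (x i ≈ 1# → d i ≤ 0#)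

  -- Neighborhoods are taken with respect to the balls of the supremum norm.
  LocalMinimizer : (Point → Carrier) → Point → Set (c ⊔ ℓ₂)
  LocalMinimizer f x =
    InBox x ×
    (∃[ ε ] 0# < ε × (∀ y → InBox y → (∀ i → ∣ y i - x i ∣< ε) → f x ≤ f y))

  -- g is the limit of (f(x + h eᵢ) - f(x)) / h as h → 0, h ≠ 0; the argument
  -- h⁻¹ together with h * h⁻¹ ≈ 1# expresses that h is nonzero.
  IsPartialDerivative : (Point → Carrier) → Point → Fin n → Carrier → Set (c ⊔ ℓ₁ ⊔ ℓ₂)
  IsPartialDerivative f x i g =
    ∀ ε → 0# < ε → ∃[ δ ] 0# < δ ×
    (∀ h h⁻¹ → h * h⁻¹ ≈ 1# → ∣ h ∣< δ →
      ∣ (f (λ j → x j + h * e i j) - f x) * h⁻¹ - g ∣< ε)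

  IsGradient : (Point → Carrier) → Point → Point → Set (c ⊔ ℓ₁ ⊔ ℓ₂)
  IsGradient f x g = ∀ i → IsPartialDerivative f x i (g i)

  CoreBinarity : (Point → Carrier) → Set (c ⊔ ℓ₁ ⊔ ℓ₂)
  CoreBinarity f = ∀ x → LocalMinimizer f x → Binary x

  RemovalDirection : Point → Set ℓ₁
  RemovalDirection d = ∃[ i ] ∀ j → d j ≈ - e i j

module Precedence {c ℓ₁ ℓ₂} (ℝ : RealNumbers c ℓ₁ ℓ₂) {n : ℕ} (G : PrecedenceGraph n) where

  open RealNumbers ℝ
  open PrecedenceGraph G
  open Euclidean ℝ n public

  Feasible : Point → Set ℓ₂
  Feasible x = ∀ i j → j ∈ pred i → x i ≤ x j

  V-anc : Point → Carrier
  V-anc x = sum λ c → sum λ α →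
    if does (ancestor? α c) then x c * (1# - x α) else 0#

  f̂ : Point → Carrier → Point → Carrier
  f̂ w γ x = - ⟨ w , x ⟩ + γ * V-anc x

  -- The existence of the gradient is part of the claim; a gradient is unique
  -- up to _≈_, so it is immaterial that it is bound existentially.
  LocallyRepairable : ∀ {ℓ} → (Point → Carrier) → (Point → Set ℓ) → Carrier →
                      Set (c ⊔ ℓ₁ ⊔ ℓ₂ ⊔ ℓ)
  LocallyRepairable V D δ =
    ∀ x → Binary x → ¬ Feasible x →
    ∃[ ∇V ] IsGradient V x ∇V ×
    (∃[ d ] D d × TangentCone x d × ⟨ ∇V , d ⟩ ≤ - δ)

-- V-anc is affine along each coordinate line, because acyclicity excludes the
-- term with c = α.  If the binary point x is infeasible, choose i maximal for
-- the ancestor order among the blocks with xᵢ = 1 that have an ancestor at 0.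
-- Every descendant of i then sits at 0, so ∂ᵢV-anc counts the ancestors of i at
-- 0 and is at least 1.  Hence -eᵢ repairs x with margin 1, and when wᵢ < γ a
-- small step along -eᵢ strictly decreases f̂, so x is not a local minimizer.

module Submission where

open import Defs
import Algebra.Properties.AbelianGroup as AbelianGroupProperties
import Algebra.Properties.Ring as RingProperties
import Algebra.Properties.Semiring.Sum as SemiringSum
import Algebra.Solver.Ring.NaturalCoefficients.Default as SemiringSolver
open import Data.Bool.Base using (if_then_else_)
open import Data.Empty using (⊥-elim)
open import Data.Fin.Base using (Fin)
open import Data.Fin.Induction using (spo-noetherian)
import Data.Fin.Properties as Fin
open import Data.Fin.Subset.Properties using (_∈?_)
open import Data.Nat.Base using (ℕ; zero; suc)
open import Data.Product.Base using (∃-syntax; _×_; _,_; proj₁; proj₂)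
open import Data.Sum.Base using (inj₁; inj₂; [_,_]′)
open import Data.Vec.Functional using (Vector; removeAt)
open import Function.Base using (id; flip; _∘_)
open import Induction.WellFounded using (WellFounded; Acc; acc)
open import Relation.Binary.Construct.Closure.Transitive using ([_]; _++_)
open import Relation.Binary.PropositionalEquality as ≡ using (_≢_)
import Relation.Binary.Reasoning.Setoid as SetoidReasoning
open import Relation.Binary.Structures using (IsStrictPartialOrder)
open import Relation.Nullary.Decidable using (Dec; yes; no; does; _×-dec_; dec-true; dec-false; toSum)
open import Relation.Nullary.Negation using (¬_; contradiction)

-- Inequalities in a constructive ordered field, and finite sums.

module Ordered {c ℓ₁ ℓ₂} (ℝ : RealNumbers c ℓ₁ ℓ₂) where

  open RealNumbers ℝ
  open AbelianGroupProperties +-abelianGroup public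
    using () renaming (xyx⁻¹≈y to x+y-x≈y; ⁻¹-involutive to -‿involutive;
                       ⁻¹-∙-comm to -‿+-comm)
  open RingProperties ring public
    using (-0#≈0#; -‿distribˡ-*; -‿distribʳ-*; x[y-z]≈xy-xz)
  open SemiringSum semiring public
    using (sum-remove; sum-cong-≋; ∑-distrib-+; *-distribˡ-sum; sum)
  open SetoidReasoning setoid
  open IsStrictPartialOrder isStrictPartialOrder public
    using () renaming (irrefl to <-irrefl; trans to <-trans;
                       <-respˡ-≈ to <-respˡ; <-respʳ-≈ to <-respʳ)

  ≤-reflexive : ∀ {x y} → x ≈ y → x ≤ y
  ≤-reflexive x≈y = <-irrefl (sym x≈y)

  <⇒≤ : ∀ {x y} → x < y → x ≤ y
  <⇒≤ x<y y<x = <-irrefl refl (<-trans x<y y<x)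

  -- Cotransitivity takes the place of trichotomy: comparing the third point with `x < y` leaves two
  -- cases, one of which `y ≤ z` refutes.
  <-≤-trans : ∀ {x y z} → x < y → y ≤ z → x < z
  <-≤-trans x<y y≤z = [ id , ⊥-elim ∘ y≤z ]′ (<-cotrans x<y _)

  ≤-trans : ∀ {x y z} → x ≤ y → y ≤ z → x ≤ z
  ≤-trans x≤y y≤z z<x = [ y≤z , x≤y ]′ (<-cotrans z<x _)

  1≉0 : ¬ 1# ≈ 0#
  1≉0 1≈0 = <-irrefl (sym 1≈0) 0<1

  +-monoʳ-< : ∀ z {x y} → x < y → z + x < z + y
  +-monoʳ-< z x<y = <-respˡ (+-comm _ z) (<-respʳ (+-comm _ z) (+-monoˡ-< z x<y))

  +-cancelʳ-< : ∀ z {x y} → x + z < y + z → x < y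
  +-cancelʳ-< z x+z<y+z = <-respˡ (cancel _) (<-respʳ (cancel _) (+-monoˡ-< (- z) x+z<y+z))
    where
    cancel : ∀ x → x + z - z ≈ x
    cancel x = begin
      x + z - z    ≈⟨ +-assoc x z (- z) ⟩
      x + (z - z)  ≈⟨ +-congˡ (-‿inverseʳ z) ⟩
      x + 0#       ≈⟨ +-identityʳ x ⟩
      x            ∎

  -- As `≤` is a negated `<`, each summand is handled by cancellation read contrapositively, with
  -- `y + u` as the intermediate value.
  +-mono-≤ : ∀ {x y u v} → x ≤ y → u ≤ v → x + u ≤ y + v
  +-mono-≤ {x} {y} {u} {v} x≤y u≤v =
    ≤-trans {y = y + u} (x≤y ∘ +-cancelʳ-< u)
      (u≤v ∘ +-cancelʳ-< y ∘ <-respˡ (+-comm y v) ∘ <-respʳ (+-comm y u))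

  x<y⇒0<y-x : ∀ {x y} → x < y → 0# < y - x
  x<y⇒0<y-x {x} x<y = <-respˡ (-‿inverseʳ x) (+-monoˡ-< (- x) x<y)

  0<y-x⇒x<y : ∀ {x y} → 0# < y - x → x < y
  0<y-x⇒x<y {x} 0<y-x = +-cancelʳ-< (- x) (<-respˡ (sym (-‿inverseʳ x)) 0<y-x)

  0<x⇒-x<0 : ∀ {x} → 0# < x → - x < 0#
  0<x⇒-x<0 0<x = 0<y-x⇒x<y (<-respʳ (sym (trans (+-identityˡ _) (-‿involutive _))) 0<x)

  x<0⇒0<-x : ∀ {x} → x < 0# → 0# < - x
  x<0⇒0<-x x<0 = <-respʳ (+-identityˡ _) (x<y⇒0<y-x x<0)

  -‿mono-≤ : ∀ {x y} → x ≤ y → - y ≤ - x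
  -‿mono-≤ x≤y -x<-y =
    x≤y (0<y-x⇒x<y (<-respʳ (trans (+-comm _ _) (+-congʳ (-‿involutive _))) (x<y⇒0<y-x -x<-y)))

  -- Strict positivity of the cofactor would need a longer argument; its double
  -- negation follows from tightness.
  *-cancel-pos : ∀ {x y} → 0# < x → 0# < x * y → ¬ y ≤ 0#
  *-cancel-pos {x} {y} 0<x 0<xy y≤0 = <-irrefl refl (<-respʳ xy≈0 0<xy)
    where
    0≤y : 0# ≤ y
    0≤y y<0 = <⇒≤ 0<xy (<-respˡ (trans (-‿cong (sym (-‿distribʳ-* x y))) (-‿involutive _))
                                (0<x⇒-x<0 (*-pos 0<x (x<0⇒0<-x y<0))))

    xy≈0 : x * y ≈ 0#
    xy≈0 = trans (*-congˡ (<-tight 0≤y y≤0)) (zeroʳ x)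

  -- The conclusion is a negation, so the doubly negated positivity of `x - y` supplied by
  -- `*-cancel-pos` is enough.
  *-monoʳ-≤ : ∀ {x y z} → 0# < z → x ≤ y → z * x ≤ z * y
  *-monoʳ-≤ {x} {y} {z} 0<z x≤y zy<zx =
    *-cancel-pos 0<z (<-respʳ (sym (x[y-z]≈xy-xz z x y)) (x<y⇒0<y-x zy<zx))
      (x≤y ∘ 0<y-x⇒x<y)

  sum-nonNegative : ∀ {n} (t : Vector Carrier n) → (∀ i → 0# ≤ t i) → 0# ≤ sum t
  sum-nonNegative {zero} t 0≤t = <-irrefl refl
  sum-nonNegative {suc n}  t 0≤t =
    ≤-trans (≤-reflexive (sym (+-identityˡ 0#)))
      (+-mono-≤ (0≤t Fin.zero) (sum-nonNegative _ (0≤t ∘ Fin.suc)))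

  term≤sum : ∀ {n} (t : Vector Carrier n) → (∀ i → 0# ≤ t i) → ∀ i → t i ≤ sum t
  term≤sum {suc n} t 0≤t i =
    ≤-trans (≤-reflexive (sym (+-identityʳ (t i))))
      (≤-trans (+-mono-≤ (<-irrefl refl) (sum-nonNegative (removeAt t i) (λ _ → 0≤t _)))
        (≤-reflexive (sym (sum-remove {i = i} t))))

  sum-zero : ∀ {n} (t : Vector Carrier n) → (∀ i → t i ≈ 0#) → sum t ≈ 0#
  sum-zero {zero} t t≈0 = refl
  sum-zero {suc n}  t t≈0 =
    trans (+-cong (t≈0 Fin.zero) (sum-zero _ (t≈0 ∘ Fin.suc))) (+-identityˡ 0#)

  sum-single : ∀ {n} (t : Vector Carrier n) i → (∀ j → i ≢ j → t j ≈ 0#) → sum t ≈ t i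
  sum-single {suc n} t i t≈0 = begin
    sum t       ≈⟨ sum-remove {i = i} t ⟩
    t i + _     ≈⟨ +-congˡ (sum-zero _ λ j → t≈0 _ (Fin.punchInᵢ≢i i j ∘ ≡.sym)) ⟩
    t i + 0#    ≈⟨ +-identityʳ (t i) ⟩
    t i         ∎

  sum-affine : ∀ {n} (s t : Vector Carrier n) h →
               sum (λ i → s i + h * t i) ≈ sum s + h * sum t
  sum-affine s t h =
    trans (∑-distrib-+ s (λ i → h * t i)) (+-congˡ (sym (*-distribˡ-sum h t)))

-- Functions affine along a coordinate line, and steps inside the box.

module Directional {c ℓ₁ ℓ₂} (ℝ : RealNumbers c ℓ₁ ℓ₂) (n : ℕ) where

  open RealNumbers ℝ
  open Euclidean ℝ n hiding (sum)
  open Ordered ℝ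
  open SetoidReasoning setoid

  eᵢᵢ≈1 : ∀ i → e i i ≈ 1#
  eᵢᵢ≈1 i = reflexive (≡.cong (if_then 1# else 0#) (dec-true (i Fin.≟ i) ≡.refl))

  eᵢⱼ≈0 : ∀ {i j} → i ≢ j → e i j ≈ 0#
  eᵢⱼ≈0 {i} {j} i≢j = reflexive (≡.cong (if_then 1# else 0#) (dec-false (i Fin.≟ j) i≢j))

  shift : Point → Fin n → Carrier → Point
  shift x i h j = x j + h * e i j

  shift-off : ∀ x {i j} h → i ≢ j → shift x i h j ≈ x j
  shift-off x h i≢j =
    trans (+-congˡ (trans (*-congˡ (eᵢⱼ≈0 i≢j)) (zeroʳ h))) (+-identityʳ _)

  shift-on : ∀ x i h → shift x i h i ≈ x i + h
  shift-on x i h = +-congˡ (trans (*-congˡ (eᵢᵢ≈1 i)) (*-identityʳ h))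

  -- The identity is required for every `h`, so the slope `g` yields both the partial derivative and
  -- the exact change of `f` over a finite step.
  AffineAlong : (Point → Carrier) → Point → Fin n → Carrier → Set _
  AffineAlong f x i g = ∀ h → f (shift x i h) ≈ f x + h * g

  affine⇒partialDerivative : ∀ f x i {g} → AffineAlong f x i g → IsPartialDerivative f x i g
  affine⇒partialDerivative f x i {g} affine ε 0<ε =
    -- The difference quotient equals `g` exactly, so any positive radius works.
    1# , 0<1 , λ h h⁻¹ hh⁻¹≈1 _ → let
      error≈0 : (f (shift x i h) - f x) * h⁻¹ - g ≈ 0#
      error≈0 = begin
        (f (shift x i h) - f x) * h⁻¹ - g  ≈⟨ +-congʳ (*-congʳ (+-congʳ (affine h))) ⟩
        (f x + h * g - f x) * h⁻¹ - g      ≈⟨ +-congʳ (*-congʳ (x+y-x≈y _ _)) ⟩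
        h * g * h⁻¹ - g                    ≈⟨ +-congʳ (*-congʳ (*-comm h g)) ⟩
        g * h * h⁻¹ - g                    ≈⟨ +-congʳ (*-assoc g h h⁻¹) ⟩
        g * (h * h⁻¹) - g                  ≈⟨ +-congʳ (*-congˡ hh⁻¹≈1) ⟩
        g * 1# - g                         ≈⟨ +-congʳ (*-identityʳ g) ⟩
        g - g                              ≈⟨ -‿inverseʳ g ⟩
        0#                                 ∎
      in <-respʳ (sym error≈0) (0<x⇒-x<0 0<ε) , <-respˡ (sym error≈0) 0<ε

  ⟨u,e⟩ : ∀ (u : Point) i → sum (λ j → u j * e i j) ≈ u i
  ⟨u,e⟩ u i =
    trans (sum-single _ i λ j i≢j → trans (*-congˡ (eᵢⱼ≈0 i≢j)) (zeroʳ (u j)))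
          (trans (*-congˡ (eᵢᵢ≈1 i)) (*-identityʳ (u i)))

  ⟨u,-e⟩ : ∀ (u : Point) i → ⟨ u , (λ j → - e i j) ⟩ ≈ - u i
  ⟨u,-e⟩ u i =
    trans (sum-single _ i λ j i≢j →
             trans (*-congˡ (trans (-‿cong (eᵢⱼ≈0 i≢j)) -0#≈0#)) (zeroʳ (u j)))
          (trans (sym (-‿distribʳ-* _ _))
                 (-‿cong (trans (*-congˡ (eᵢᵢ≈1 i)) (*-identityʳ (u i)))))

  linear-affine : ∀ (w x : Point) i → AffineAlong ⟨ w ,_⟩ x i (w i)
  linear-affine w x i h = begin
    sum (λ j → w j * shift x i h j)
      ≈⟨ sum-cong-≋ (λ j → solve 4 (λ w x h e → w :* (x :+ h :* e) := w :* x :+ h :* (w :* e))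
                                   refl (w j) (x j) h (e i j)) ⟩
    sum (λ j → w j * x j + h * (w j * e i j))
      ≈⟨ sum-affine (λ j → w j * x j) (λ j → w j * e i j) h ⟩
    ⟨ w , x ⟩ + h * sum (λ j → w j * e i j)
      ≈⟨ +-congˡ (*-congˡ (⟨u,e⟩ w i)) ⟩
    ⟨ w , x ⟩ + h * w i ∎
    where open SemiringSolver commutativeSemiring

  shift-inBox : ∀ {x i t} → InBox x → x i ≈ 1# → 0# < t → t < 1# → InBox (shift x i (- t))
  shift-inBox {x} {i} {t} box xᵢ≈1 0<t t<1 j with toSum (i Fin.≟ j)
  ... | inj₂ i≢j = ≤-trans (proj₁ (box j)) (≤-reflexive (sym (shift-off x (- t) i≢j)))
               , ≤-trans (≤-reflexive (shift-off x (- t) i≢j)) (proj₂ (box j))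
  ... | inj₁ ≡.refl = <⇒≤ (<-respʳ (sym on) (x<y⇒0<y-x t<1))
                   , <⇒≤ (<-respˡ (sym on) (<-respʳ (+-identityʳ 1#) (+-monoʳ-< 1# (0<x⇒-x<0 0<t))))
    where
    on : shift x i (- t) i ≈ 1# - t
    on = trans (shift-on x i (- t)) (+-congʳ xᵢ≈1)

  shift-near : ∀ {x i t ε} → 0# < t → t < ε → ∀ j → ∣ shift x i (- t) j - x j ∣< ε
  shift-near {x} {i} {t} {ε} 0<t t<ε j with toSum (i Fin.≟ j)
  ... | inj₂ i≢j = <-respʳ (sym Δ≈0) (0<x⇒-x<0 0<ε) , <-respˡ (sym Δ≈0) 0<ε
    where
    0<ε : 0# < ε
    0<ε = <-trans 0<t t<ε

    Δ≈0 : shift x i (- t) j - x j ≈ 0#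
    Δ≈0 = trans (+-congʳ (shift-off x (- t) i≢j)) (-‿inverseʳ (x j))
  ... | inj₁ ≡.refl = <-respʳ (sym Δ≈-t) -ε<-t
                   , <-respˡ (sym Δ≈-t) (<-trans (0<x⇒-x<0 0<t) (<-trans 0<t t<ε))
    where
    Δ≈-t : shift x i (- t) i - x i ≈ - t
    Δ≈-t = trans (+-congʳ (shift-on x i (- t))) (x+y-x≈y (x i) (- t))

    -ε<-t : - ε < - t
    -ε<-t = 0<y-x⇒x<y (<-respʳ (trans (+-comm ε (- t)) (+-congˡ (sym (-‿involutive ε))))
                               (x<y⇒0<y-x t<ε))

  -- The step length is t = ε / (1 + ε), for which 1 - t = 1 / (1 + ε) and ε - t = t ε.
  ¬¬step : ∀ {ε} → 0# < ε → ¬ (∀ t → 0# < t → t < 1# → ¬ t < ε)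
  ¬¬step {ε} 0<ε none =
    *-cancel-pos 0<1+ε (<-respʳ (sym inv) 0<1) λ 0<r →
      none (ε * r) (*-pos 0<ε 0<r)
        (0<y-x⇒x<y (<-respʳ r≈1-t 0<r))
        (0<y-x⇒x<y (<-respʳ tε≈ε-t (*-pos (*-pos 0<ε 0<r) 0<ε)))
    where
    open SemiringSolver commutativeSemiring

    0<1+ε : 0# < 1# + ε
    0<1+ε = <-trans 0<1 (<-respˡ (+-identityʳ 1#) (+-monoʳ-< 1# 0<ε))

    r : Carrier
    r = proj₁ (invertible (inj₂ 0<1+ε))

    inv : (1# + ε) * r ≈ 1#
    inv = proj₂ (proj₂ (invertible (inj₂ 0<1+ε)))

    r≈1-t : r ≈ 1# - ε * r
    r≈1-t = begin
      r                        ≈⟨ x+y-x≈y (ε * r) r ⟨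
      ε * r + r - ε * r        ≈⟨ +-congʳ (solve 2 (λ ε r → ε :* r :+ r := (con 1 :+ ε) :* r) refl ε r) ⟩
      (1# + ε) * r - ε * r     ≈⟨ +-congʳ inv ⟩
      1# - ε * r               ∎

    tε≈ε-t : ε * r * ε ≈ ε - ε * r
    tε≈ε-t = begin
      ε * r * ε                         ≈⟨ x+y-x≈y (ε * r) _ ⟨
      ε * r + ε * r * ε - ε * r         ≈⟨ +-congʳ (solve 2 (λ ε r → ε :* r :+ ε :* r :* ε := ε :* ((con 1 :+ ε) :* r)) refl ε r) ⟩
      ε * ((1# + ε) * r) - ε * r        ≈⟨ +-congʳ (trans (*-congˡ inv) (*-identityʳ ε)) ⟩
      ε - ε * r                         ∎

  -- A step of length `t` along `- e i` changes `f` by `- (t * g)`, which is negative. The bound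
  -- `t < 1#` keeps the point in the box and `t < ε` keeps it in the neighborhood. Such a `t` is
  -- available up to double negation, which suffices for refuting minimality.
  ascent⇒¬localMinimizer : ∀ f x i {g} → AffineAlong f x i g → x i ≈ 1# → 0# < g →
                           ¬ LocalMinimizer f x
  ascent⇒¬localMinimizer f x i {g} affine xᵢ≈1 0<g (box , ε , 0<ε , minimal) =
    ¬¬step 0<ε λ t 0<t t<1 t<ε →
      minimal (shift x i (- t)) (shift-inBox box xᵢ≈1 0<t t<1) (shift-near {x} {i} 0<t t<ε)
        (<-respˡ (sym (affine (- t)))
          (<-respʳ (+-identityʳ (f x))
            (+-monoʳ-< (f x)
              (<-respˡ (-‿distribˡ-* t g) (0<x⇒-x<0 (*-pos 0<t 0<g))))))

-- The gradient of the ancestor penalty.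

module Repair {c ℓ₁ ℓ₂} (ℝ : RealNumbers c ℓ₁ ℓ₂) {n : ℕ} (G : PrecedenceGraph n) where

  open RealNumbers ℝ
  open PrecedenceGraph G
  open Precedence ℝ G hiding (sum)
  open Ordered ℝ
  open Directional ℝ n
  open SetoidReasoning setoid

  ancestor⇒≢ : ∀ {α c} → Ancestor α c → α ≢ c
  ancestor⇒≢ a ≡.refl = acyclic _ a

  term : Point → Fin n → Fin n → Carrier
  term x c α = if does (ancestor? α c) then x c * (1# - x α) else 0#

  -- The product rule for `x c * (1# - x α)` in coordinate `i`. Summed over `c` and `α`, it gives
  -- the total of `1# - x α` over the ancestors `α` of `i` minus the total of `x c` over the
  -- descendants `c` of `i`.
  ∇term : Point → Fin n → Fin n → Fin n → Carrier
  ∇term x i c α =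
    if does (ancestor? α c) then e i c * (1# - x α) + - e i α * x c else 0#

  ∇V-anc : Point → Point
  ∇V-anc x i = sum λ c → sum λ α → ∇term x i c α

  e-disjoint : ∀ i {j k} → j ≢ k → e i j * e i k ≈ 0#
  e-disjoint i {j} {k} j≢k with toSum (i Fin.≟ j)
  ... | inj₂ i≢j     = trans (*-congʳ (eᵢⱼ≈0 i≢j)) (zeroˡ _)
  ... | inj₁ ≡.refl = trans (*-congˡ (eᵢⱼ≈0 j≢k)) (zeroʳ _)

  -- Each summand is a product of two factors affine in `h`. Its coefficient of `h * h` is
  -- `- (e i c * e i α)`, which vanishes because an ancestor `α` of `c` differs from `c`.
  V-anc-affine : ∀ x i → AffineAlong V-anc x i (∇V-anc x i)
  V-anc-affine x i h = begin
    V-anc (shift x i h)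
      ≈⟨ sum-cong-≋ (λ c → trans (sum-cong-≋ (term-affine c)) (sum-affine (term x c) (∇term x i c) h)) ⟩
    sum (λ c → sum (term x c) + h * sum (∇term x i c))
      ≈⟨ sum-affine (λ c → sum (term x c)) (λ c → sum (∇term x i c)) h ⟩
    V-anc x + h * ∇V-anc x i ∎
    where
    open SemiringSolver commutativeSemiring

    term-affine : ∀ c α → term (shift x i h) c α ≈ term x c α + h * ∇term x i c α
    term-affine c α with ancestor? α c
    ... | no _  = sym (trans (+-identityˡ _) (zeroʳ h))
    ... | yes a = begin
      (x c + h * p) * (1# - (x α + h * q))
        -- The solver works over a commutative semiring, so negation is first moved onto `q`, and
        -- `- q` is then passed to it as a variable.
        ≈⟨ *-congˡ (begin
             1# - (x α + h * q)        ≈⟨ +-congˡ (-‿+-comm _ _) ⟨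
             1# + (- x α + - (h * q))  ≈⟨ +-assoc _ _ _ ⟨
             1# - x α + - (h * q)      ≈⟨ +-congˡ (-‿distribʳ-* h q) ⟩
             1# - x α + h * - q        ∎) ⟩
      (x c + h * p) * (1# - x α + h * - q)
        ≈⟨ solve 5 (λ y z h p q → (y :+ h :* p) :* (z :+ h :* q) :=
                      (y :* z :+ h :* (p :* z :+ q :* y)) :+ h :* h :* (p :* q))
                   refl (x c) (1# - x α) h p (- q) ⟩
      x c * (1# - x α) + h * (p * (1# - x α) + - q * x c) + h * h * (p * - q)
        ≈⟨ +-congˡ (trans (*-congˡ p*-q≈0) (zeroʳ _)) ⟩
      x c * (1# - x α) + h * (p * (1# - x α) + - q * x c) + 0#
        ≈⟨ +-identityʳ _ ⟩
      x c * (1# - x α) + h * (p * (1# - x α) + - q * x c) ∎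
      where
      p q : Carrier
      p = e i c
      q = e i α

      p*-q≈0 : p * - q ≈ 0#
      p*-q≈0 = begin
        p * - q    ≈⟨ -‿distribʳ-* p q ⟨
        - (p * q)  ≈⟨ -‿cong (e-disjoint i (ancestor⇒≢ a ∘ ≡.sym)) ⟩
        - 0#       ≈⟨ -0#≈0# ⟩
        0#         ∎

  f̂-affine : ∀ w γ x i → AffineAlong (f̂ w γ) x i (γ * ∇V-anc x i - w i)
  f̂-affine w γ x i h = begin
    - ⟨ w , shift x i h ⟩ + γ * V-anc (shift x i h)
      ≈⟨ +-cong (-‿cong (linear-affine w x i h)) (*-congˡ (V-anc-affine x i h)) ⟩
    - (⟨ w , x ⟩ + h * w i) + γ * (V-anc x + h * ∇V-anc x i)
      ≈⟨ +-congʳ (sym (-‿+-comm _ _)) ⟩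
    - ⟨ w , x ⟩ + - (h * w i) + γ * (V-anc x + h * ∇V-anc x i)
      ≈⟨ +-congʳ (+-congˡ (-‿distribʳ-* h (w i))) ⟩
    - ⟨ w , x ⟩ + h * - w i + γ * (V-anc x + h * ∇V-anc x i)
      ≈⟨ solve 6 (λ l h w γ v g → l :+ h :* w :+ γ :* (v :+ h :* g) :=
                    l :+ γ :* v :+ h :* (γ :* g :+ w))
                 refl (- ⟨ w , x ⟩) h (- w i) γ (V-anc x) (∇V-anc x i) ⟩
    f̂ w γ x + h * (γ * ∇V-anc x i - w i) ∎
    where open SemiringSolver commutativeSemiring

  -- Maximal violated blocks of an infeasible binary point.

  Violated : Point → Fin n → Set _
  Violated x i = x i ≈ 1# × ∃[ α ] Ancestor α i × x α ≈ 0#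

  -- A descendant of `i` at 1 would be violated by the same ancestor as `i`. At a binary point,
  -- maximality among violated blocks therefore amounts to all descendants being at 0.
  MaximalViolated : Point → Fin n → Set _
  MaximalViolated x i = Violated x i × (∀ d → Ancestor i d → x d ≈ 0#)

  descendant-noetherian : WellFounded (flip Ancestor)
  descendant-noetherian = spo-noetherian record
    { isEquivalence = ≡.isEquivalence
    ; irrefl        = λ { ≡.refl → acyclic _ }
    ; trans         = _++_
    ; <-resp-≈      = ≡.resp₂ Ancestor
    }

  module _ {x : Point} (binary : Binary x) where

    one? : ∀ i → Dec (x i ≈ 1#)
    one? i with binary i
    ... | inj₁ xᵢ≈0 = no λ xᵢ≈1 → 1≉0 (trans (sym xᵢ≈1) xᵢ≈0)
    ... | inj₂ xᵢ≈1 = yes xᵢ≈1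

    ≉1⇒≈0 : ∀ {i} → ¬ x i ≈ 1# → x i ≈ 0#
    ≉1⇒≈0 {i} xᵢ≉1 = [ id , ⊥-elim ∘ xᵢ≉1 ]′ (binary i)

    zero? : ∀ i → Dec (x i ≈ 0#)
    zero? i with binary i
    ... | inj₁ xᵢ≈0 = yes xᵢ≈0
    ... | inj₂ xᵢ≈1 = no λ xᵢ≈0 → 1≉0 (trans (sym xᵢ≈1) xᵢ≈0)

    violated⇒maximal : ∀ {i} → Violated x i → Acc (flip Ancestor) i → ∃[ j ] MaximalViolated x j
    violated⇒maximal {i} v@(_ , α , α<i , xα≈0) (acc rs)
      with Fin.any? (λ d → ancestor? i d ×-dec one? d)
    -- The witness `α` is kept: it is an ancestor of `d` by transitivity. This is why `Violated`
    -- refers to ancestors and not to direct predecessors.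
    ... | yes (d , i<d , xd≈1) = violated⇒maximal (xd≈1 , α , α<i ++ i<d , xα≈0) (rs i<d)
    ... | no none = i , v , λ d i<d → ≉1⇒≈0 λ xd≈1 → none (d , i<d , xd≈1)

    -- Infeasibility is a negated universal statement and carries no witness. Binarity makes it
    -- decidable whether an edge is violated, so a finite search finds one, from which the climb to
    -- a maximal block starts.
    infeasible⇒maximal : ¬ Feasible x → ∃[ i ] MaximalViolated x i
    infeasible⇒maximal infeasible
      with Fin.any? (λ i → one? i ×-dec Fin.any? λ j → j ∈? pred i ×-dec zero? j)
    ... | yes (i , xᵢ≈1 , j , j∈ , xⱼ≈0) =
      violated⇒maximal (xᵢ≈1 , j , [ j∈ ] , xⱼ≈0) (descendant-noetherian i)
    ... | no none = ⊥-elim (infeasible feasible)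
      where
      feasible : Feasible x
      feasible i j j∈ with binary i | binary j
      ... | inj₁ xᵢ≈0 | inj₁ xⱼ≈0 = ≤-reflexive (trans xᵢ≈0 (sym xⱼ≈0))
      ... | inj₁ xᵢ≈0 | inj₂ xⱼ≈1 = <⇒≤ (<-respˡ (sym xᵢ≈0) (<-respʳ (sym xⱼ≈1) 0<1))
      ... | inj₂ xᵢ≈1 | inj₁ xⱼ≈0 = contradiction (i , xᵢ≈1 , j , j∈ , xⱼ≈0) none
      ... | inj₂ xᵢ≈1 | inj₂ xⱼ≈1 = ≤-reflexive (trans xᵢ≈1 (sym xⱼ≈1))

    1-x≈1 : ∀ {j} → x j ≈ 0# → 1# - x j ≈ 1#
    1-x≈1 xⱼ≈0 = trans (+-congˡ (trans (-‿cong xⱼ≈0) -0#≈0#)) (+-identityʳ 1#)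

    0≤1-x : ∀ j → 0# ≤ 1# - x j
    0≤1-x j = [ (λ xⱼ≈0 → <⇒≤ (<-respʳ (sym (1-x≈1 xⱼ≈0)) 0<1))
              , (λ xⱼ≈1 → ≤-reflexive (sym (trans (+-congˡ (-‿cong xⱼ≈1)) (-‿inverseʳ 1#))))
              ]′ (binary j)

    -- Lower bound on the partial derivative at a maximal violated block.

    module _ {i} (maximal : MaximalViolated x i) where

      ancestor-term : ∀ {α} → Ancestor α i → e i i * (1# - x α) + - e i α * x i ≈ 1# - x α
      ancestor-term {α} a = begin
        e i i * (1# - x α) + - e i α * x i
          ≈⟨ +-cong (*-congʳ (eᵢᵢ≈1 i))
                    (*-congʳ (trans (-‿cong (eᵢⱼ≈0 (ancestor⇒≢ a ∘ ≡.sym))) -0#≈0#)) ⟩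
        1# * (1# - x α) + 0# * x i
          ≈⟨ +-cong (*-identityˡ _) (zeroˡ _) ⟩
        1# - x α + 0#
          ≈⟨ +-identityʳ _ ⟩
        1# - x α ∎

      -- A negative contribution could come only from `α` equal to `i`. Then `c` is a descendant of
      -- `i`, and maximality puts `x c` at 0.
      other-term : ∀ {c α} → i ≢ c → Ancestor α c → e i c * (1# - x α) + - e i α * x c ≈ 0#
      other-term {c} {α} i≢c a = begin
        e i c * (1# - x α) + - e i α * x c
          ≈⟨ +-cong (trans (*-congʳ (eᵢⱼ≈0 i≢c)) (zeroˡ _)) descendant ⟩
        0# + 0#
          ≈⟨ +-identityˡ 0# ⟩
        0# ∎
        where
        descendant : - e i α * x c ≈ 0#
        descendant with toSum (i Fin.≟ α)
        ... | inj₁ ≡.refl = trans (*-congˡ (proj₂ maximal c a)) (zeroʳ _)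
        ... | inj₂ i≢α     = trans (*-congʳ (trans (-‿cong (eᵢⱼ≈0 i≢α)) -0#≈0#)) (zeroˡ _)

      ancestor-summand-nonNegative : ∀ {c α} → Ancestor α c →
                                     0# ≤ e i c * (1# - x α) + - e i α * x c
      ancestor-summand-nonNegative {c} {α} a with toSum (i Fin.≟ c)
      ... | inj₁ ≡.refl = ≤-trans (0≤1-x α) (≤-reflexive (sym (ancestor-term a)))
      ... | inj₂ i≢c    = ≤-reflexive (sym (other-term i≢c a))

      ∇term-nonNegative : ∀ c α → 0# ≤ ∇term x i c α
      ∇term-nonNegative c α with ancestor? α c
      ... | no _  = <-irrefl refl
      ... | yes a = ancestor-summand-nonNegative a

      ∇term-violation : ∀ {α} → Ancestor α i → x α ≈ 0# → ∇term x i i α ≈ 1#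
      ∇term-violation {α} a xα≈0 with ancestor? α i
      ... | no ¬a = contradiction a ¬a
      ... | yes _ = trans (ancestor-term a) (1-x≈1 xα≈0)

      -- All summands are nonnegative, and the one at `c = i` with `α` the violating ancestor equals
      -- 1. It is bounded first by its inner sum and then by the double sum.
      1≤∇V-anc : 1# ≤ ∇V-anc x i
      1≤∇V-anc = let (_ , α , α<i , xα≈0) , _ = maximal in
        ≤-trans (≤-reflexive (sym (∇term-violation α<i xα≈0)))
          (≤-trans (term≤sum (∇term x i i) (∇term-nonNegative i) α)
            (term≤sum (λ c → sum (∇term x i c))
                      (λ c → sum-nonNegative (∇term x i c) (∇term-nonNegative c)) i))

  -- Repair by removal, and feasibility of binary local minimizers.

  removal-tangent : ∀ {x i} → x i ≈ 1# → TangentCone x (λ j → - e i j)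
  removal-tangent {x} {i} xᵢ≈1 j with toSum (i Fin.≟ j)
  ... | inj₁ ≡.refl = (λ xᵢ≈0 → ⊥-elim (1≉0 (trans (sym xᵢ≈1) xᵢ≈0)))
                    , λ _ → <⇒≤ (0<x⇒-x<0 (<-respʳ (sym (eᵢᵢ≈1 i)) 0<1))
  ... | inj₂ i≢j = (λ _ → ≤-reflexive (sym -e≈0)) , λ _ → ≤-reflexive -e≈0
    where
    -e≈0 : - e i j ≈ 0#
    -e≈0 = trans (-‿cong (eᵢⱼ≈0 i≢j)) -0#≈0#

  -- Pairing the gradient with `- e i` gives the negated partial derivative at `i`, so the margin is
  -- exactly the bound `1≤∇V-anc`.
  locallyRepairable : LocallyRepairable V-anc RemovalDirection 1#
  locallyRepairable x binary infeasible with infeasible⇒maximal binary infeasible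
  ... | i , maximal@((xᵢ≈1 , _) , _) =
    ∇V-anc x , (λ j → affine⇒partialDerivative V-anc x j (V-anc-affine x j)) ,
    (λ j → - e i j) , (i , λ _ → refl) , removal-tangent xᵢ≈1 ,
    ≤-trans (≤-reflexive (⟨u,-e⟩ (∇V-anc x) i)) (-‿mono-≤ (1≤∇V-anc binary maximal))

  localMinimizer⇒feasible : ∀ {w γ} → 0# < γ → (∀ i → w i < γ) →
                            ∀ {x} → Binary x → LocalMinimizer (f̂ w γ) x → Feasible x
  localMinimizer⇒feasible {w} {γ} 0<γ w<γ {x} binary minimizer i j j∈ xⱼ<xᵢ
    -- `x i ≤ x j` unfolds to the negation of `x j < x i`, so a violated edge is at hand and a
    -- contradiction is sought.
    with infeasible⇒maximal binary (λ feasible → feasible i j j∈ xⱼ<xᵢ)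
  ... | k , maximal@((xₖ≈1 , _) , _) =
    ascent⇒¬localMinimizer (f̂ w γ) x k (f̂-affine w γ x k) xₖ≈1
      -- The slope of `f̂ w γ` at `k` is positive because `w k < γ`, and `γ ≈ γ * 1#` is at most
      -- `γ * ∇V-anc x k`.
      (x<y⇒0<y-x (<-≤-trans (<-respʳ (sym (*-identityʳ γ)) (w<γ k))
                            (*-monoʳ-≤ 0<γ (1≤∇V-anc binary maximal))))
      minimizer

proposition3p1 : ∀ {c ℓ₁ ℓ₂} (ℝ : RealNumbers c ℓ₁ ℓ₂) (n : ℕ) (G : PrecedenceGraph n) →
    let open RealNumbers ℝ
        open Precedence ℝ G
    in (w : Point) (γ : Carrier) → 0# < γ →
       CoreBinarity (f̂ w γ) →
       LocallyRepairable V-anc RemovalDirection 1# ×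
       ((∀ i → w i < γ) → ∀ x → Binary x → LocalMinimizer (f̂ w γ) x → Feasible x)
proposition3p1 ℝ n G w γ 0<γ _ =
  locallyRepairable , λ w<γ x → localMinimizer⇒feasible 0<γ w<γ
  where open Repair ℝ G
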